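{- For each integer $k\ge 1$, every oriented graph $D$ with more than $(3k-4)|V(D)|/2$ edges contains each antidirected path of length $k$ (as a subgraph).
   Context: All digraphs are finite. A digraph has directed edges, at most one for each direction between each pair of distinct vertices (no loops); $uv$ denotes an edge from $u$ to $v$. An oriented graph is a digraph in which for each pair of vertices $u,v$ at most one of the edges $uv$, $vu$ is present. $V(D)$ denotes the vertex set of $D$. An antidirected path (antipath) is an orientation of a path in which every vertex has, within the path, either out-degree $0$ or in-degree $0$; that is, edge directions alternate along the path. Its length is its number of edges. Up to isomorphism there is exactly one antidirected path of length $k$ if $k$ is odd, and there are exactly two if $k\ge 2$ is even (both end-edges directed away from the endvertices, or both directed towards the endvertices); "each antidirected path of length $k$" means all of these.
   Formalization: The oriented graph is additionally assumed to have at least one edge; for k = 1 the bound is negative and edgeless graphs would be counterexamples, while for k ≥ 2 the edge bound already implies this. -}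

module Defs where

open import Data.Fin using (Fin; toℕ)
open import Data.List using (length; filter; allFin; cartesianProduct)
open import Data.Nat using (ℕ; suc)
open import Data.Product using (Σ-syntax; _×_; uncurry)
open import Data.Sum using (_⊎_)
open import Function.Bundles using (_↔_; _⇔_; Inverse)
open import Function.Definitions using (Injective)
open import Level using (0ℓ)
open import Relation.Binary.Core using (Rel)
open import Relation.Binary.Definitions using (Asymmetric; Decidable; Irreflexive)
open import Relation.Binary.PropositionalEquality using (_≡_)

record Digraph : Set₁ where
  field
    order    : ℕ
    Edge     : Rel (Fin order) 0ℓ
    edge?    : Decidable Edge
    loopless : Irreflexive _≡_ Edge

  V : Set
  V = Fin order

  size : ℕ
  size = length (filter (uncurry edge?) (cartesianProduct (allFin order) (allFin order)))

  outDegree : V → ℕ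
  outDegree u = length (filter (λ v → edge? u v) (allFin order))

  inDegree : V → ℕ
  inDegree v = length (filter (λ u → edge? u v) (allFin order))

  Adjacent : Rel V 0ℓ
  Adjacent u v = Edge u v ⊎ Edge v u

open Digraph public

IsOriented : Digraph → Set
IsOriented D = Asymmetric (Edge D)

Consecutive : ∀ {n} → Rel (Fin n) 0ℓ
Consecutive i j = toℕ j ≡ suc (toℕ i) ⊎ toℕ i ≡ suc (toℕ j)

-- Length counts edges, so a path of length k has suc k vertices.
record IsOrientationOfPath (k : ℕ) (P : Digraph) : Set where
  field
    oriented    : IsOriented P
    enumeration : Fin (suc k) ↔ V P
    adjacency   : ∀ i j →
      Adjacent P (Inverse.to enumeration i) (Inverse.to enumeration j) ⇔ Consecutive i j

record IsAntipath (k : ℕ) (P : Digraph) : Set where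
  field
    isOrientationOfPath : IsOrientationOfPath k P
    alternating         : ∀ v → outDegree P v ≡ 0 ⊎ inDegree P v ≡ 0

-- Subgraphs need not be induced: only edges, not non-edges, are preserved.
_Contains_ : Digraph → Digraph → Set
D Contains P = Σ[ f ∈ (V P → V D) ]
  Injective _≡_ _≡_ f × (∀ {u v} → Edge P u v → Edge D (f u) (f v))

{-# OPTIONS --safe #-}

-- Work in the bipartite double cover, where each vertex occurs as a tail and as
-- a head; an antipath of D is a path there that uses no vertex of D twice.
-- Deleting light tails and heads, with different weights on the two sides,
-- leaves a subgraph in which tails have out-degree > A/2 and heads in-degree
-- > B/2. Extend a path one vertex at a time by Pósa rotations at its first vertex.
-- Suppose that none of the p first vertices obtained by a rotation has more
-- neighbours on the path than the original one, and that none can be joined to a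
-- vertex of D off the path. Then these p vertices must send more than
-- p (p - 1) / 2 arcs to one another, which is impossible in an oriented graph.
-- Splitting (3k - 4)/2 suitably into A/2 and B/2 makes this work at every length
-- below k.

module Submission where

open import Defs
open import Data.Bool using (Bool; true; false; not; _∧_; _xor_; if_then_else_)
import Data.Bool.Properties as Bool
open import Data.Empty using (⊥; ⊥-elim)
open import Data.Fin as Fin using (Fin; zero; suc; toℕ; inject₁)
import Data.Fin.Properties as Fin
import Data.Integer as ℤ
import Data.Integer.Properties as ℤ
import Data.Integer.Tactic.RingSolver as ℤSolver
open import Data.List using (List; []; _∷_; [_]; _++_; length; map; filter; lookup; cartesianProduct; allFin)
import Data.List.Membership.DecPropositional as DecMembership
open import Data.List.Membership.Propositional using (_∈_; _∉_; find; lose)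
open import Data.List.Membership.Propositional.Properties using (∈-∃++; ∈-lookup; ∈-filter⁺; ∈-allFin)
open import Data.List.Properties using (map-∘; map-++; ++-identityʳ; length-tabulate)
open import Data.List.Relation.Binary.Permutation.Propositional using (_↭_; ↭-refl; ↭-sym; ↭-trans; ↭-reflexive; ↭⇒↭ₛ)
open import Data.List.Relation.Binary.Permutation.Propositional.Properties using (shift; map⁺; All-resp-↭; ∈-resp-↭; ↭-length)
import Data.List.Relation.Binary.Permutation.Setoid.Properties as ↭ₛ
open import Data.List.Relation.Binary.Sublist.Propositional using (_⊆_; []; _∷_; _∷ʳ_)
open import Data.List.Relation.Unary.All as All using (All; []; _∷_)
open import Data.List.Relation.Unary.All.Properties using (¬Any⇒All¬)
open import Data.List.Relation.Unary.AllPairs using ([]; _∷_)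
open import Data.List.Relation.Unary.Any using (Any; here; there; any?)
open import Data.List.Relation.Unary.Linked using (Linked; []; [-]; _∷_)
open import Data.List.Relation.Unary.Unique.Propositional using (Unique)
open import Data.List.Relation.Unary.Unique.Propositional.Properties using (allFin⁺)
open import Data.Nat using (ℕ; zero; suc; _+_; _*_; _≤_; _<_; z≤n; s≤s; s≤s⁻¹; _≤?_; _<?_)
open import Data.Nat.ListAction using (sum)
open import Data.Nat.ListAction.Properties using (sum-↭; sum-++)
open import Data.Nat.Properties hiding (_≟_; _≤?_; _<?_)
open import Data.Nat.Tactic.RingSolver using (solve-∀)
open import Data.Product using (Σ-syntax; ∃-syntax; _×_; _,_; proj₁; proj₂; uncurry)
open import Data.Sum using (_⊎_; inj₁; inj₂)
open import Function using (_∘_; const; id; case_of_)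
open import Function.Bundles using (Inverse; Equivalence)
open import Relation.Binary.Definitions using (DecidableEquality)
open import Relation.Binary.PropositionalEquality using (_≡_; refl; sym; trans; cong; cong₂; subst; subst₂; setoid; module ≡-Reasoning)
open import Relation.Nullary using (Dec; does; ¬_; yes; no; contradiction; ¬?; _×-dec_)
open import Relation.Nullary.Decidable using (dec-false; decidable-stable)
open import Relation.Unary using (Decidable)

private
  variable
    A B : Set

-- Sums over lists.

∑ : (A → ℕ) → List A → ℕ
∑ f = sum ∘ map f

∑-↭ : ∀ (f : A → ℕ) {xs ys} → xs ↭ ys → ∑ f xs ≡ ∑ f ys
∑-↭ f = sum-↭ ∘ map⁺ f

∑-cong : ∀ {f g : A → ℕ} → (∀ x → f x ≡ g x) → ∀ xs → ∑ f xs ≡ ∑ g xs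
∑-cong f≗g []       = refl
∑-cong f≗g (x ∷ xs) = cong₂ _+_ (f≗g x) (∑-cong f≗g xs)

∑-mono : ∀ {f g : A → ℕ} {xs} → All (λ x → f x ≤ g x) xs → ∑ f xs ≤ ∑ g xs
∑-mono []           = z≤n
∑-mono (f≤g ∷ fs≤gs) = +-mono-≤ f≤g (∑-mono fs≤gs)

∑-const : ∀ c (xs : List A) → ∑ (const c) xs ≡ length xs * c
∑-const c []       = refl
∑-const c (x ∷ xs) = cong (c +_) (∑-const c xs)

∑-+ : ∀ (f g : A → ℕ) xs → ∑ (λ x → f x + g x) xs ≡ ∑ f xs + ∑ g xs
∑-+ f g []       = refl
∑-+ f g (x ∷ xs) rewrite ∑-+ f g xs = interchange (f x) (g x) (∑ f xs) (∑ g xs)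
  where
  interchange : ∀ a b c d → a + b + (c + d) ≡ a + c + (b + d)
  interchange = solve-∀

∑-*ˡ : ∀ c (f : A → ℕ) xs → ∑ (λ x → c * f x) xs ≡ c * ∑ f xs
∑-*ˡ c f []       = sym (*-zeroʳ c)
∑-*ˡ c f (x ∷ xs) = trans (cong (c * f x +_) (∑-*ˡ c f xs)) (sym (*-distribˡ-+ c (f x) (∑ f xs)))

∑-swap : ∀ (f : A → B → ℕ) xs ys → ∑ (λ x → ∑ (f x) ys) xs ≡ ∑ (λ y → ∑ (λ x → f x y) xs) ys
∑-swap f []       ys = sym (trans (∑-const 0 ys) (*-zeroʳ (length ys)))
∑-swap f (x ∷ xs) ys =
  trans (cong (∑ (f x) ys +_) (∑-swap f xs ys)) (sym (∑-+ (f x) (λ y → ∑ (λ x → f x y) xs) ys))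

-- `ys` may contain repetitions: each element of `xs` with a positive value claims one occurrence in
-- `ys`, and `Unique xs` keeps later elements from needing it again.
∑-support : ∀ (f : A → ℕ) {xs} ys → Unique xs → (∀ {x} → x ∈ xs → 0 < f x → x ∈ ys) → ∑ f xs ≤ ∑ f ys
∑-support f ys [] _ = z≤n
∑-support f {x ∷ xs} ys (x∉xs ∷ uniq) xs⊆ys with 0 <? f x
... | no fx≮0 rewrite n≤0⇒n≡0 (≮⇒≥ fx≮0) = ∑-support f ys uniq (xs⊆ys ∘ there)
... | yes 0<fx with ys₁ , ys₂ , refl ← ∈-∃++ (xs⊆ys (here refl) 0<fx) = begin
  f x + ∑ f xs           ≤⟨ +-monoʳ-≤ (f x) (∑-support f (ys₁ ++ ys₂) uniq xs⊆) ⟩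
  f x + ∑ f (ys₁ ++ ys₂) ≡⟨ ∑-↭ f (shift x ys₁ ys₂) ⟨
  ∑ f (ys₁ ++ x ∷ ys₂)   ∎
  where
  open ≤-Reasoning
  xs⊆ : ∀ {z} → z ∈ xs → 0 < f z → z ∈ ys₁ ++ ys₂
  xs⊆ z∈xs 0<fz with ∈-resp-↭ (shift x ys₁ ys₂) (xs⊆ys (there z∈xs) 0<fz)
  ... | here refl  = contradiction refl (All.lookup x∉xs z∈xs)
  ... | there z∈ys = z∈ys

𝟙 : Bool → ℕ
𝟙 false = 0
𝟙 true  = 1

-- An unordered pair of positions contributes at most 1 and the diagonal nothing, so n entries give
-- at most n (n - 1) / 2; the form avoids division and subtraction.
∑-tournament : ∀ (h : A → A → ℕ) → (∀ x → h x x ≡ 0) → (∀ x y → h x y + h y x ≤ 1) →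
               ∀ xs → 2 * ∑ (λ x → ∑ (h x) xs) xs + length xs ≤ length xs * length xs
∑-tournament h irr asym [] = z≤n
∑-tournament h irr asym (x ∷ xs) = begin
  2 * (h x x + R + ∑ (λ y → h y x + ∑ (h y) xs) xs) + suc n
    ≡⟨ cong₂ (λ i j → 2 * (i + R + j) + suc n) (irr x) (∑-+ (λ y → h y x) (λ y → ∑ (h y) xs) xs) ⟩
  2 * (R + (C + T)) + suc n ≡⟨ regroup R C T n ⟩
  2 * (R + C) + 1 + (2 * T + n)
    ≤⟨ +-mono-≤ (+-monoˡ-≤ 1 (*-monoʳ-≤ 2 R+C≤n)) (∑-tournament h irr asym xs) ⟩
  2 * n + 1 + n * n ≡⟨ square n ⟩
  suc n * suc n ∎
  where
  open ≤-Reasoning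
  n = length xs
  R = ∑ (h x) xs
  C = ∑ (λ y → h y x) xs
  T = ∑ (λ y → ∑ (h y) xs) xs
  regroup : ∀ R C T n → 2 * (R + (C + T)) + suc n ≡ 2 * (R + C) + 1 + (2 * T + n)
  regroup = solve-∀
  square : ∀ n → 2 * n + 1 + n * n ≡ suc n * suc n
  square = solve-∀
  R+C≤n : R + C ≤ n
  R+C≤n = begin
    R + C                    ≡⟨ ∑-+ (h x) (λ y → h y x) xs ⟨
    ∑ (λ y → h x y + h y x) xs ≤⟨ ∑-mono (All.universal (asym x) xs) ⟩
    ∑ (const 1) xs           ≡⟨ ∑-const 1 xs ⟩
    n * 1                    ≡⟨ *-identityʳ n ⟩
    n                        ∎

-- The bipartite double cover.

Node : Set → Set
Node V = Bool × V

onSide : Bool → Node A → Bool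
onSide b (c , _) = not b xor c

sideCount : Bool → List (Node A) → ℕ
sideCount b = ∑ (𝟙 ∘ onSide b)

module _ {V : Set} (arc : V → V → Bool) where

  -- `(true , u)` is `u` as a tail and `(false , u)` is `u` as a head; `arcAt b` reads arcs from the
  -- side `b`.
  arcAt : Bool → V → V → Bool
  arcAt true  u v = arc u v
  arcAt false u v = arc v u

  adj : Node V → Node V → Bool
  adj (b , u) (c , v) = (b xor c) ∧ arcAt b u v

  Adj : Node V → Node V → Set
  Adj x y = adj x y ≡ true

  adjCount : Node V → List (Node V) → ℕ
  adjCount x = ∑ (𝟙 ∘ adj x)

-- Rotations and counting along a path.

module Extension {V : Set} (_≟_ : DecidableEquality V) (arc : V → V → Bool)
  (antisym : ∀ {u v} → arc u v ≡ true → arc v u ≡ false)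
  (side : Bool → List V) (unique : ∀ b → Unique (side b))
  (weight : Bool → ℕ)
  (dense : ∀ b {u} → u ∈ side b → weight b < 2 * ∑ (𝟙 ∘ arcAt arc b u) (side (not b)))
  where

  open DecMembership _≟_ using (_∈?_)

  Adj-sym : ∀ {x y} → Adj arc x y → Adj arc y x
  Adj-sym {true , _}  {false , _} p = p
  Adj-sym {false , _} {true , _}  p = p

  Active : Node V → Set
  Active (b , u) = u ∈ side b

  arc-irrefl : ∀ u → 𝟙 (arc u u) ≡ 0
  arc-irrefl u with arc u u in eq
  ... | false = refl
  ... | true  with () ← trans (sym eq) (antisym eq)

  arc-asym : ∀ u v → 𝟙 (arc u v) + 𝟙 (arc v u) ≤ 1
  arc-asym u v with arc u v in eq
  ... | true rewrite antisym eq = ≤-refl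
  ... | false with arc v u
  ...   | true  = ≤-refl
  ...   | false = z≤n

  hits : Bool → V → V → ℕ
  hits τ u v = 𝟙 (arcAt arc τ u v)

  -- Arcs are counted between the underlying vertices, whatever their roles on the path.
  -- Orientedness of the digraph enters here.
  arcAt-tournament : ∀ τ (S : List (Node V)) → let T = ∑ (λ s → ∑ (hits τ (proj₂ s) ∘ proj₂) S) S in
    2 * T + length S ≤ length S * length S
  arcAt-tournament true  = ∑-tournament _ (arc-irrefl ∘ proj₂) (λ x y → arc-asym (proj₂ x) (proj₂ y))
  arcAt-tournament false = ∑-tournament _ (arc-irrefl ∘ proj₂) (λ x y → arc-asym (proj₂ y) (proj₂ x))

  -- The first vertices of the paths obtained from the path z ∷ l by rotation: the
  -- predecessors of the neighbours of z, and the last vertex when it is on the side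
  -- of z, as the reversed path starts there. The arguments x and l traverse the path.
  endpoints : Node V → Node V → List (Node V) → List (Node V)
  endpoints z x [] with onSide (proj₁ z) x
  ... | true  = [ x ]
  ... | false = []
  endpoints z x (y ∷ l) with adj arc z y
  ... | true  = x ∷ endpoints z y l
  ... | false = endpoints z y l

  -- A sublist rather than a subset, since `occupancy` recurses over this embedding.
  endpoints-⊆ : ∀ z x l → endpoints z x l ⊆ x ∷ l
  endpoints-⊆ z x [] with onSide (proj₁ z) x
  ... | true  = refl ∷ []
  ... | false = x ∷ʳ []
  endpoints-⊆ z x (y ∷ l) with adj arc z y
  ... | true  = refl ∷ endpoints-⊆ z y l
  ... | false = x ∷ʳ endpoints-⊆ z y l

  onSide⇒≡ : ∀ {b c} {v : V} → onSide b (c , v) ≡ true → c ≡ b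
  onSide⇒≡ {true}  {true}  _ = refl
  onSide⇒≡ {false} {false} _ = refl

  adj-side : ∀ {x y z} → Adj arc x y → Adj arc z y → proj₁ x ≡ proj₁ z
  adj-side {true , _}  {false , _} {true , _}  _ _ = refl
  adj-side {false , _} {true , _}  {false , _} _ _ = refl

  -- A predecessor shares a neighbour with `z`, and adjacency changes sides.
  endpoints-side : ∀ z x {l} → Linked (Adj arc) (x ∷ l) → All (λ s → proj₁ s ≡ proj₁ z) (endpoints z x l)
  endpoints-side z x [-] with onSide (proj₁ z) x in eq
  ... | true  = onSide⇒≡ {v = proj₂ x} eq ∷ []
  ... | false = []
  endpoints-side z x (_∷_ {y = y} xy path) with adj arc z y in zy
  ... | true  = adj-side {x} {y} {z} xy zy ∷ endpoints-side z y path
  ... | false = endpoints-side z y path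

  lastSide : Node V → List (Node V) → Bool
  lastSide x []      = proj₁ x
  lastSide x (y ∷ l) = lastSide y l

  length-endpoints : ∀ z x l → length (endpoints z x l) ≡
                     adjCount arc z l + 𝟙 (not (proj₁ z) xor lastSide x l)
  length-endpoints z x [] with onSide (proj₁ z) x
  ... | true  = refl
  ... | false = refl
  length-endpoints z x (y ∷ l) with adj arc z y
  ... | true  = cong suc (length-endpoints z y l)
  ... | false = length-endpoints z y l

  -- Sides alternate along a path, so the counts differ only if both ends are on one side. This
  -- expresses the correction term of `length-endpoints` through the counts.
  sideCounts : ∀ x {l} → Linked (Adj arc) (x ∷ l) →
    sideCount (proj₁ x) (x ∷ l) ≡
    sideCount (not (proj₁ x)) (x ∷ l) + 𝟙 (not (proj₁ x) xor lastSide x l)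
  sideCounts (true , _)  [-] = refl
  sideCounts (false , _) [-] = refl
  sideCounts (true , _) {(false , v) ∷ l} (_ ∷ path) =
    trans (carry (lastSide (false , v) l) (sideCount true l))
          (cong (_+ 𝟙 (lastSide (false , v) l)) (sym (sideCounts (false , v) path)))
    where
    carry : ∀ b m → 1 + m ≡ m + 𝟙 (not b) + 𝟙 b
    carry true  m = trans (+-comm 1 m) (cong (_+ 1) (sym (+-identityʳ m)))
    carry false m = trans (+-comm 1 m) (sym (+-identityʳ (m + 1)))
  sideCounts (false , _) {(true , v) ∷ l} (_ ∷ path) =
    trans (carry (lastSide (true , v) l) (sideCount false l))
          (cong (_+ 𝟙 (not (lastSide (true , v) l))) (sym (sideCounts (true , v) path)))
    where
    carry : ∀ b m → 1 + m ≡ m + 𝟙 b + 𝟙 (not b)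
    carry true  m = trans (+-comm 1 m) (sym (+-identityʳ (m + 1)))
    carry false m = trans (+-comm 1 m) (cong (_+ 1) (sym (+-identityʳ m)))

  -- The traversed part z … x is kept reversed as x ∷ acc; `join` says that it can be
  -- closed up with the rest of the path at a neighbour y of its last element z.
  rotate : ∀ {z s} x acc {l} →
    (∀ {y ys} → Adj arc z y → Linked (Adj arc) (y ∷ ys) → Linked (Adj arc) (x ∷ acc ++ y ∷ ys)) →
    Linked (Adj arc) (x ∷ acc) → Linked (Adj arc) (x ∷ l) → s ∈ endpoints z x l →
    ∃[ l′ ] Linked (Adj arc) (s ∷ l′) × s ∷ l′ ↭ x ∷ acc ++ l

  rotate-past : ∀ {z s} x acc →
    (∀ {y ys} → Adj arc z y → Linked (Adj arc) (y ∷ ys) → Linked (Adj arc) (x ∷ acc ++ y ∷ ys)) →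
    Linked (Adj arc) (x ∷ acc) → ∀ {y l} → Adj arc x y → Linked (Adj arc) (y ∷ l) → s ∈ endpoints z y l →
    ∃[ l′ ] Linked (Adj arc) (s ∷ l′) × s ∷ l′ ↭ x ∷ acc ++ y ∷ l

  rotate {z} x acc join back [-] s∈ with onSide (proj₁ z) x | s∈
  ... | true | here refl = acc , back , ↭-reflexive (cong (x ∷_) (sym (++-identityʳ acc)))
  rotate {z} x acc join back (_∷_ {y = y} xy path) s∈ with adj arc z y in zy
  ... | false = rotate-past x acc join back xy path s∈
  ... | true with s∈
  -- The rotation proper: the edge from `x` to `y` gives way to the one from `z` to `y`, and the
  -- part before `y` is reversed.
  ...   | here refl = acc ++ y ∷ _ , join zy path , ↭-refl
  ...   | there s∈′ = rotate-past x acc join back xy path s∈′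

  rotate-past {z} x acc join back {y} {l} xy path s∈
    with l′ , path′ , perm ← rotate y (x ∷ acc) (λ zy ys → Adj-sym {x} {y} xy ∷ join zy ys)
                                    (Adj-sym {x} {y} xy ∷ back) path s∈ =
    l′ , path′ , ↭-trans perm (↭-sym (shift y (x ∷ acc) l))

  endpoint-path : ∀ {z s l} → Linked (Adj arc) (z ∷ l) → s ∈ endpoints z z l →
    ∃[ l′ ] Linked (Adj arc) (s ∷ l′) × s ∷ l′ ↭ z ∷ l
  endpoint-path {z} = rotate z [] _∷_ [-]

  -- Hits on the other side are adjacencies. A node on the side `τ` is charged 1, except that nodes
  -- of `S` are charged their actual hits; `length S` on the left offsets their share of
  -- `sideCount`.
  occupancy : ∀ τ u {S l : List (Node V)} → S ⊆ l → All (λ s → proj₁ s ≡ τ) S →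
    length S + ∑ (hits τ u ∘ proj₂) l ≤
    adjCount arc (τ , u) l + sideCount τ l + ∑ (hits τ u ∘ proj₂) S
  occupancy τ u [] [] = z≤n
  occupancy τ u {S} {(c , v) ∷ l} (_ ∷ʳ S⊆l) S-side = begin
    length S + (hits τ u v + ∑ (hits τ u ∘ proj₂) l) ≡⟨ shuffle (length S) (hits τ u v) _ ⟩
    hits τ u v + (length S + ∑ (hits τ u ∘ proj₂) l)
      ≤⟨ +-mono-≤ (split τ c) (occupancy τ u S⊆l S-side) ⟩
    _ ≡⟨ regroup (𝟙 (adj arc (τ , u) (c , v))) (𝟙 (onSide τ (c , v))) (adjCount arc (τ , u) l)
               (sideCount τ l) (∑ (hits τ u ∘ proj₂) S) ⟩
    _ ∎
    where
    open ≤-Reasoning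
    shuffle : ∀ p h t → p + (h + t) ≡ h + (p + t)
    shuffle = solve-∀
    regroup : ∀ a b c d e → a + b + (c + d + e) ≡ (a + c) + (b + d) + e
    regroup = solve-∀
    𝟙≤1 : ∀ b → 𝟙 b ≤ 1
    𝟙≤1 true  = ≤-refl
    𝟙≤1 false = z≤n
    split : ∀ τ c → hits τ u v ≤ 𝟙 (adj arc (τ , u) (c , v)) + 𝟙 (onSide τ (c , v))
    split true  true  = 𝟙≤1 _
    split false false = 𝟙≤1 _
    split true  false = m≤m+n _ 0
    split false true  = m≤m+n _ 0
  occupancy τ u {(_ , v) ∷ S} {_ ∷ l} (refl ∷ S⊆l) (refl ∷ S-side) = begin
    suc (length S) + (hits τ u v + ∑ (hits τ u ∘ proj₂) l) ≡⟨ shuffle (length S) (hits τ u v) _ ⟩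
    suc (hits τ u v) + (length S + ∑ (hits τ u ∘ proj₂) l)
      ≤⟨ +-monoʳ-≤ (suc (hits τ u v)) (occupancy τ u S⊆l S-side) ⟩
    _ ≡⟨ regroup (hits τ u v) (adjCount arc (τ , u) l) (sideCount τ l) (∑ (hits τ u ∘ proj₂) S) ⟩
    _ ≤⟨ +-monoˡ-≤ _ (+-mono-≤ (m≤n+m _ (𝟙 (adj arc (τ , u) (τ , v)))) (same τ)) ⟩
    _ ∎
    where
    open ≤-Reasoning
    shuffle : ∀ p h t → suc p + (h + t) ≡ suc h + (p + t)
    shuffle = solve-∀
    regroup : ∀ h c d e → suc h + (c + d + e) ≡ c + suc d + (h + e)
    regroup = solve-∀
    same : ∀ τ → suc (sideCount τ l) ≤ 𝟙 (onSide τ (τ , v)) + sideCount τ l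
    same true  = ≤-refl
    same false = ≤-refl

  vertices : List (Node V) → List V
  vertices = map proj₂

  -- The last condition accepts a vertex that lies on the path in either role: it blocks extension
  -- even where it gives no edge of the double cover.
  Saturated : Bool → ℕ → List (Node V) → Node V → Set
  Saturated τ a l s = proj₁ s ≡ τ × Active s × adjCount arc s l ≤ a ×
    All (λ w → arcAt arc τ (proj₂ s) w ≡ true → w ∈ vertices l) (side (not τ))

  -- All arcs counted by `dense` end on the path, where `occupancy` bounds their number.
  saturated-bound : ∀ τ a {s S l} → S ⊆ l → All (λ s → proj₁ s ≡ τ) S → Saturated τ a l s →
    2 * length S + suc (weight τ) ≤ 2 * (a + sideCount τ l) + 2 * ∑ (hits τ (proj₂ s) ∘ proj₂) S
  saturated-bound τ a {_ , u} {S} {l} S⊆l S-side (refl , u∈ , adj≤a , inside) = begin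
    2 * length S + suc (weight τ) ≤⟨ +-monoʳ-≤ (2 * length S) (dense τ u∈) ⟩
    2 * length S + 2 * ∑ (hits τ u) (side (not τ))
      ≤⟨ +-monoʳ-≤ (2 * length S) (*-monoʳ-≤ 2 degree≤) ⟩
    2 * length S + 2 * ∑ (hits τ u ∘ proj₂) l ≡⟨ *-distribˡ-+ 2 (length S) _ ⟨
    2 * (length S + ∑ (hits τ u ∘ proj₂) l) ≤⟨ *-monoʳ-≤ 2 (occupancy τ u S⊆l S-side) ⟩
    2 * (adjCount arc (τ , u) l + sideCount τ l + ∑ (hits τ u ∘ proj₂) S)
      ≤⟨ *-monoʳ-≤ 2 (+-monoˡ-≤ _ (+-monoˡ-≤ (sideCount τ l) adj≤a)) ⟩
    2 * (a + sideCount τ l + ∑ (hits τ u ∘ proj₂) S) ≡⟨ *-distribˡ-+ 2 (a + sideCount τ l) _ ⟩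
    2 * (a + sideCount τ l) + 2 * ∑ (hits τ u ∘ proj₂) S ∎
    where
    open ≤-Reasoning
    hit : ∀ b → 0 < 𝟙 b → b ≡ true
    hit true _ = refl
    degree≤ : ∑ (hits τ u) (side (not τ)) ≤ ∑ (hits τ u ∘ proj₂) l
    degree≤ = begin
      ∑ (hits τ u) (side (not τ))
        ≤⟨ ∑-support (hits τ u) (vertices l) (unique (not τ)) (λ w∈ 0<hit → All.lookup inside w∈ (hit _ 0<hit)) ⟩
      ∑ (hits τ u) (vertices l)  ≡⟨ cong sum (map-∘ l) ⟨
      ∑ (hits τ u ∘ proj₂) l     ∎

  -- Summing `saturated-bound` over the p elements of `S` leaves the arcs within `S`, which
  -- `arcAt-tournament` bounds by p (p - 1) / 2; then p cancels, `S` being nonempty.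
  crowded : ∀ τ a {S l} → S ⊆ l → 0 < length S → All (Saturated τ a l) S →
    length S + suc (suc (weight τ)) ≤ 2 * (a + sideCount τ l)
  crowded τ a {S@(_ ∷ _)} {l} S⊆l _ sat = *-cancelˡ-≤ p (+-cancelʳ-≤ (p * p) _ _ (begin
    p * (p + suc (suc c)) + p * p ≡⟨ regroup p c ⟩
    p * (2 * p + suc c) + p       ≡⟨ cong (_+ p) (∑-const (2 * p + suc c) S) ⟨
    ∑ (const (2 * p + suc c)) S + p
      ≤⟨ +-monoˡ-≤ p (∑-mono (All.map (saturated-bound τ a S⊆l (All.map proj₁ sat)) sat)) ⟩
    ∑ (λ s → K + 2 * f s) S + p        ≡⟨ cong (_+ p) (∑-+ (const K) (λ s → 2 * f s) S) ⟩
    ∑ (const K) S + ∑ (λ s → 2 * f s) S + p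
      ≡⟨ cong₂ (λ i j → i + j + p) (∑-const K S) (∑-*ˡ 2 f S) ⟩
    p * K + 2 * ∑ f S + p              ≡⟨ +-assoc (p * K) _ p ⟩
    p * K + (2 * ∑ f S + p)            ≤⟨ +-monoʳ-≤ (p * K) (arcAt-tournament τ S) ⟩
    p * K + p * p ∎))
    where
    open ≤-Reasoning
    p = length S
    c = weight τ
    K = 2 * (a + sideCount τ l)
    f : Node V → ℕ
    f s = ∑ (hits τ (proj₂ s) ∘ proj₂) S
    regroup : ∀ p c → p * (p + suc (suc c)) + p * p ≡ p * (2 * p + suc c) + p
    regroup = solve-∀

  -- Growing a path one vertex at a time.

  record Path (τ : Bool) (p q : ℕ) : Set where
    field
      {start} : V
      {rest}  : List (Node V)
    nodes : List (Node V)
    nodes = (τ , start) ∷ rest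
    field
      linked   : Linked (Adj arc) nodes
      -- Required of the underlying vertices, so none occurs both as a tail and as a head.
      distinct : Unique (vertices nodes)
      active   : All Active nodes
      same     : sideCount τ nodes ≡ p
      opposite : sideCount (not τ) nodes ≡ q

  open Path

  reorder : ∀ {τ p q u l} (π : Path τ p q) → Linked (Adj arc) ((τ , u) ∷ l) → (τ , u) ∷ l ↭ nodes π → Path τ p q
  reorder {τ} π path perm = record
    { linked   = path
    ; distinct = ↭ₛ.Unique-resp-↭ (setoid V) (↭⇒↭ₛ (map⁺ proj₂ (↭-sym perm))) (distinct π)
    ; active   = All-resp-↭ (↭-sym perm) (active π)
    ; same     = trans (∑-↭ (𝟙 ∘ onSide τ) perm) (same π)
    ; opposite = trans (∑-↭ (𝟙 ∘ onSide (not τ)) perm) (opposite π)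
    }

  adj≤opposite : ∀ τ {u} l → adjCount arc (τ , u) l ≤ sideCount (not τ) l
  adj≤opposite τ {u} l = ∑-mono (All.universal (bound τ) l)
    where
    bound : ∀ τ z → 𝟙 (adj arc (τ , u) z) ≤ 𝟙 (onSide (not τ) z)
    bound true  (true , _)  = z≤n
    bound false (false , _) = z≤n
    bound true  (false , v) with arc u v
    ... | true  = ≤-refl
    ... | false = z≤n
    bound false (true , v) with arc v u
    ... | true  = ≤-refl
    ... | false = z≤n

  prepend : ∀ {τ p q} (π : Path τ p q) {w} → w ∈ side (not τ) → arcAt arc τ (start π) w ≡ true →
            w ∉ vertices (nodes π) → Path (not τ) (suc q) p
  prepend {τ} π {w} w∈ hit w∉ = record
    { linked   = Adj-sym {τ , start π} {not τ , w} (joined τ hit) ∷ linked π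
    ; distinct = All.tabulate (λ x∈ w≡x → w∉ (subst (_∈ vertices (nodes π)) (sym w≡x) x∈)) ∷ distinct π
    ; active   = w∈ ∷ active π
    ; same     = cong₂ _+_ (own (not τ)) (opposite π)
    ; opposite = trans (back τ (nodes π)) (same π)
    }
    where
    joined : ∀ τ → arcAt arc τ (start π) w ≡ true → Adj arc (τ , start π) (not τ , w)
    joined true  h = h
    joined false h = h
    own : ∀ b → 𝟙 (onSide b (b , w)) ≡ 1
    own true  = refl
    own false = refl
    back : ∀ b l → sideCount (not (not b)) ((not b , w) ∷ l) ≡ sideCount b l
    back true  l = refl
    back false l = refl

  turn : ∀ {τ p q s} (π : Path τ p q) → s ∈ endpoints (τ , start π) (τ , start π) (rest π) →
    Σ[ π′ ∈ Path τ p q ] s ≡ (τ , start π′) × nodes π′ ↭ nodes π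
  turn π s∈
    with refl ← All.lookup (endpoints-side _ _ (linked π)) s∈ | _ , path , perm ← endpoint-path (linked π) s∈ =
    reorder π path perm , refl , perm

  adjCount-rest : ∀ τ u l → adjCount arc (τ , u) ((τ , u) ∷ l) ≡ adjCount arc (τ , u) l
  adjCount-rest true  u l = refl
  adjCount-rest false u l = refl

  -- The surplus e of nodes on the side of the start is, by `sideCounts`, the correction for the
  -- last vertex.
  length-endpoints-path : ∀ {τ e q} (π : Path τ (e + q) q) → let z = τ , start π in
    length (endpoints z z (rest π)) ≡ adjCount arc z (nodes π) + e
  length-endpoints-path {τ} {e} {q} π = trans (length-endpoints z z (rest π))
    (cong₂ _+_ (sym (adjCount-rest τ (start π) (rest π))) (sym (+-cancelʳ-≡ q e ε (begin
      e + q                           ≡⟨ same π ⟨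
      sideCount τ (nodes π)           ≡⟨ sideCounts z (linked π) ⟩
      sideCount (not τ) (nodes π) + ε ≡⟨ cong (_+ ε) (opposite π) ⟩
      q + ε                           ≡⟨ +-comm q ε ⟩
      ε + q                           ∎))))
    where
    open ≡-Reasoning
    z = τ , start π
    ε = 𝟙 (not τ xor lastSide z (rest π))

  -- On a path with an edge the second node is a neighbour of `z`, which makes `z` itself an
  -- endpoint.
  endpoints-nonempty : ∀ {z l} → Linked (Adj arc) (z ∷ l) → 0 < length (endpoints z z l)
  endpoints-nonempty {true , _}  [-] = s≤s z≤n
  endpoints-nonempty {false , _} [-] = s≤s z≤n
  endpoints-nonempty {z} {y ∷ l} (zy ∷ _) rewrite length-endpoints z z (y ∷ l) | zy = s≤s z≤n

  headDegree : ∀ {τ p q} → Path τ p q → ℕ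
  headDegree {τ} π = adjCount arc (τ , start π) (nodes π)

  headDegree≤ : ∀ {τ p q} (π : Path τ p q) → headDegree π ≤ q
  headDegree≤ {τ} π = subst (headDegree π ≤_) (opposite π) (adj≤opposite τ (nodes π))

  -- Otherwise all a + e endpoints are saturated, where a is the head degree. As a ≤ q, `crowded`
  -- gives weight + 2 ≤ 2 q + a + e ≤ 3 q + e, against the hypothesis.
  extend-or-rotate : ∀ {τ e q} (π : Path τ (e + q) q) → 3 * q + e ≤ suc (weight τ) →
    Path (not τ) (suc q) (e + q) ⊎ Σ[ π′ ∈ Path τ (e + q) q ] headDegree π < headDegree π′
  extend-or-rotate {τ} {e} {q} π 3q+e≤ =
    case any? (λ s → a <? adjCount arc s (nodes π)) S of λ where
      (yes improvable) → let s , s∈ , a< = find improvable in inj₂ (improve s∈ a<)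
      (no ¬improvable) → case any? (λ s → any? (escapes? s) (side (not τ))) S of λ where
        (yes escaping) → let s , s∈ , out = find escaping ; w , w∈ , hit , w∉ = find out in
          inj₁ (escape s∈ w∈ hit w∉)
        (no ¬escaping) → contradiction (saturated ¬improvable ¬escaping) unsaturated
    where
    a = headDegree π
    S = endpoints (τ , start π) (τ , start π) (rest π)

    escapes? : ∀ s w → Dec (arcAt arc τ (proj₂ s) w ≡ true × w ∉ vertices (nodes π))
    escapes? (_ , u) w = (arcAt arc τ u w Bool.≟ true) ×-dec ¬? (w ∈? vertices (nodes π))

    improve : ∀ {s} → s ∈ S → a < adjCount arc s (nodes π) → Σ[ π′ ∈ Path τ (e + q) q ] a < headDegree π′
    improve {s} s∈ a< with π′ , refl , perm ← turn π s∈ =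
      π′ , subst (a <_) (sym (∑-↭ (𝟙 ∘ adj arc s) perm)) a<

    escape : ∀ {s w} → s ∈ S → w ∈ side (not τ) → arcAt arc τ (proj₂ s) w ≡ true →
             w ∉ vertices (nodes π) → Path (not τ) (suc q) (e + q)
    escape s∈ w∈ hit w∉ with π′ , refl , perm ← turn π s∈ =
      prepend π′ w∈ hit (w∉ ∘ ∈-resp-↭ (map⁺ proj₂ perm))

    saturated : ¬ Any (λ s → a < adjCount arc s (nodes π)) S →
                ¬ Any (λ s → Any (λ w → arcAt arc τ (proj₂ s) w ≡ true × w ∉ vertices (nodes π)) (side (not τ))) S →
                All (Saturated τ a (nodes π)) S
    saturated ¬improvable ¬escaping = All.tabulate λ s∈ → let π′ , eq , _ = turn π s∈ in
      cong proj₁ eq ,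
      subst Active (sym eq) (All.head (active π′)) ,
      ≮⇒≥ (λ a< → ¬improvable (lose s∈ a<)) ,
      All.tabulate λ {w} w∈ hit → decidable-stable (w ∈? vertices (nodes π))
        (λ w∉ → ¬escaping (lose s∈ (lose w∈ (hit , w∉))))

    unsaturated : ¬ All (Saturated τ a (nodes π)) S
    unsaturated sat = <-irrefl refl (begin-strict
      suc (weight τ)       <⟨ ≤-refl ⟩
      suc (suc (weight τ)) ≤⟨ +-cancelˡ-≤ (a + e) _ _ room ⟩
      2 * q + a + e        ≤⟨ +-monoˡ-≤ e (+-monoʳ-≤ (2 * q) (headDegree≤ π)) ⟩
      2 * q + q + e        ≡⟨ cong (_+ e) (+-comm (2 * q) q) ⟩
      3 * q + e            ≤⟨ 3q+e≤ ⟩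
      suc (weight τ)       ∎)
      where
      open ≤-Reasoning
      regroup : ∀ a q e → 2 * (a + (e + q)) ≡ a + e + (2 * q + a + e)
      regroup = solve-∀
      room : a + e + suc (suc (weight τ)) ≤ a + e + (2 * q + a + e)
      room = begin
        a + e + suc (suc (weight τ))    ≡⟨ cong (_+ suc (suc (weight τ))) (length-endpoints-path π) ⟨
        length S + suc (suc (weight τ)) ≤⟨ crowded τ a (endpoints-⊆ _ _ (rest π)) (endpoints-nonempty (linked π)) sat ⟩
        2 * (a + sideCount τ (nodes π)) ≡⟨ cong (λ p → 2 * (a + p)) (same π) ⟩
        2 * (a + (e + q))               ≡⟨ regroup a q e ⟩
        a + e + (2 * q + a + e)         ∎

  -- e is 1 when both ends of the path lie on the side τ, and 0 otherwise.
  extend : ∀ {τ e q} → Path τ (e + q) q → 3 * q + e ≤ suc (weight τ) → Path (not τ) (suc q) (e + q)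
  extend {τ} {e} {q} π 3q+e≤ = go q π (m≤m+n q (headDegree π))
    where
    -- Each improving rotation raises the head degree, which never exceeds q; `fuel` covers the
    -- increases still possible.
    go : ∀ fuel (π : Path τ (e + q) q) → q ≤ fuel + headDegree π → Path (not τ) (suc q) (e + q)
    go fuel π q≤ with extend-or-rotate {e = e} π 3q+e≤ | fuel
    ... | inj₁ longer         | _        = longer
    ... | inj₂ (π′ , better)  | zero     = contradiction (≤-trans better (headDegree≤ π′)) (≤⇒≯ q≤)
    ... | inj₂ (π′ , better)  | suc fuel′ = go fuel′ π′
      (≤-trans q≤ (≤-trans (≤-reflexive (sym (+-suc fuel′ _))) (+-monoʳ-≤ fuel′ better)))

  singleton : ∀ τ {u} → u ∈ side τ → Path τ 1 0
  singleton true  u∈ = record { linked = [-] ; distinct = [] ∷ [] ; active = u∈ ∷ [] ; same = refl ; opposite = refl }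
  singleton false u∈ = record { linked = [-] ; distinct = [] ∷ [] ; active = u∈ ∷ [] ; same = refl ; opposite = refl }

  module _ (τ : Bool) {u} (u∈ : u ∈ side τ) where
    mutual
      -- Extending an odd path tests `weight τ`, extending an even one `weight (not τ)`. The last
      -- even path before this one needs 3 (r - 1) ≤ `weight τ`; the `3 +` states that without
      -- subtraction.
      oddPath : ∀ r → 3 * r ≤ 3 + weight τ → 3 * r ≤ suc (weight (not τ)) → Path τ (suc r) r
      oddPath zero    _  _  = singleton τ u∈
      oddPath (suc r) h₁ h₂ = subst (λ σ → Path σ (suc (suc r)) (suc r)) (Bool.not-involutive τ)
        (extend {e = 0} (evenPath r (+-cancelˡ-≤ 3 _ _ (≤-trans (≤-reflexive (sym (*-suc 3 r))) h₁))
                           (≤-trans (*-monoʳ-≤ 3 (n≤1+n r)) h₂))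
                (≤-trans (≤-reflexive (+-identityʳ _)) h₂))

      evenPath : ∀ r → 3 * r ≤ weight τ → 3 * r ≤ suc (weight (not τ)) → Path (not τ) (suc r) (suc r)
      evenPath r h₁ h₂ = extend {e = 1} (oddPath r (≤-trans h₁ (m≤n+m _ 3)) h₂)
        (≤-trans (≤-reflexive (+-comm (3 * r) 1)) (s≤s h₁))

  length-nodes : ∀ {τ p q} (π : Path τ p q) → length (nodes π) ≡ p + q
  length-nodes {τ} {p} {q} π = begin
    length (nodes π)            ≡⟨ *-identityʳ _ ⟨
    length (nodes π) * 1        ≡⟨ ∑-const 1 (nodes π) ⟨
    ∑ (const 1) (nodes π)       ≡⟨ ∑-cong (either τ) (nodes π) ⟩
    ∑ (λ z → 𝟙 (onSide τ z) + 𝟙 (onSide (not τ) z)) (nodes π)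
      ≡⟨ ∑-+ (𝟙 ∘ onSide τ) (𝟙 ∘ onSide (not τ)) (nodes π) ⟩
    sideCount τ (nodes π) + sideCount (not τ) (nodes π) ≡⟨ cong₂ _+_ (same π) (opposite π) ⟩
    p + q                       ∎
    where
    open ≡-Reasoning
    either : ∀ τ z → 1 ≡ 𝟙 (onSide τ z) + 𝟙 (onSide (not τ) z)
    either true  (true , _)  = refl
    either true  (false , _) = refl
    either false (true , _)  = refl
    either false (false , _) = refl

-- Deleting light rows and columns.

∑-positive : ∀ (f : A → ℕ) {xs} → 0 < ∑ f xs → ∃[ x ] x ∈ xs × 0 < f x
∑-positive f {x ∷ xs} 0<∑ with f x in eq
... | suc _ = x , here refl , subst (0 <_) (sym eq) (s≤s z≤n)
... | zero  = let y , y∈ , 0<fy = ∑-positive f 0<∑ in y , there y∈ , 0<fy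

-- Dropping a light element lowers the left side by exactly `a` and the right by at most `a`. The
-- term `r` is the fixed share of the other side of the bipartition.
removeLight : ∀ (g : A → ℕ) a r {xs} → Unique xs → Any (λ x → 2 * g x ≤ a) xs →
  a * length xs + r < 2 * ∑ g xs →
  ∃[ xs′ ] Unique xs′ × length xs ≡ suc (length xs′) × a * length xs′ + r < 2 * ∑ g xs′
removeLight g a r {xs} uniq light heavy
  with x , x∈ , light-x ← find light
  with xs₁ , xs₂ , refl ← ∈-∃++ x∈
  with perm ← shift x xs₁ xs₂
  with _ ∷ uniq′ ← ↭ₛ.Unique-resp-↭ (setoid _) (↭⇒↭ₛ perm) uniq =
  xs₁ ++ xs₂ , uniq′ , ↭-length perm , +-cancelˡ-< a _ _ (begin-strict
    a + (a * n + r)              ≡⟨ regroup a n r ⟩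
    a * suc n + r                ≡⟨ cong (λ m → a * m + r) (↭-length perm) ⟨
    a * length (xs₁ ++ x ∷ xs₂) + r <⟨ heavy ⟩
    2 * ∑ g (xs₁ ++ x ∷ xs₂)     ≡⟨ cong (2 *_) (∑-↭ g perm) ⟩
    2 * (g x + ∑ g (xs₁ ++ xs₂)) ≡⟨ *-distribˡ-+ 2 (g x) _ ⟩
    2 * g x + 2 * ∑ g (xs₁ ++ xs₂) ≤⟨ +-monoˡ-≤ _ light-x ⟩
    a + 2 * ∑ g (xs₁ ++ xs₂)     ∎)
  where
  open ≤-Reasoning
  n = length (xs₁ ++ xs₂)
  regroup : ∀ a n r → a + (a * n + r) ≡ a * suc n + r
  regroup = solve-∀

record DenseCore (f : A → B → ℕ) (a b : ℕ) : Set where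
  field
    rows     : List A
    cols     : List B
    rows!    : Unique rows
    cols!    : Unique cols
    rowDense : All (λ x → a < 2 * ∑ (f x) cols) rows
    colDense : All (λ y → b < 2 * ∑ (λ x → f x y) rows) cols
    nonzero  : 0 < ∑ (λ x → ∑ (f x) cols) rows

-- Light rows and columns are deleted one by one, `∑-swap` letting columns act as rows. The strict
-- inequality is invariant, so the process cannot end in an empty core.
denseCore : ∀ (f : A → B → ℕ) a b xs ys → Unique xs → Unique ys →
  a * length xs + b * length ys < 2 * ∑ (λ x → ∑ (f x) ys) xs → DenseCore f a b
denseCore f a b xs ys = go (length xs + length ys) xs ys ≤-refl
  where
  open ≤-Reasoning
  go : ∀ fuel xs ys → length xs + length ys ≤ fuel → Unique xs → Unique ys →
    a * length xs + b * length ys < 2 * ∑ (λ x → ∑ (f x) ys) xs → DenseCore f a b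
  go zero [] [] _ _ _ heavy = contradiction heavy n≮0
  go (suc fuel) xs ys bound xs! ys! heavy
    with any? (λ x → 2 * ∑ (f x) ys ≤? a) xs | any? (λ y → 2 * ∑ (λ x → f x y) xs ≤? b) ys
  ... | no ¬light | no ¬light′ = record
    { rows! = xs! ; cols! = ys!
    ; rowDense = All.map ≰⇒> (¬Any⇒All¬ xs ¬light)
    ; colDense = All.map ≰⇒> (¬Any⇒All¬ ys ¬light′)
    ; nonzero  = *-cancelˡ-< 2 0 _ (≤-<-trans z≤n heavy)
    }
  ... | yes light | _
    with xs′ , xs′! , eq , heavy′ ← removeLight (λ x → ∑ (f x) ys) a _ xs! light heavy =
    go fuel xs′ ys (s≤s⁻¹ (subst (λ n → n + length ys ≤ _) eq bound)) xs′! ys! heavy′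
  ... | no _ | yes light
    with ys′ , ys′! , eq , heavy′ ← removeLight (λ y → ∑ (λ x → f x y) xs) b (a * length xs) ys! light (begin-strict
           b * length ys + a * length xs      ≡⟨ +-comm (b * length ys) _ ⟩
           a * length xs + b * length ys      <⟨ heavy ⟩
           2 * ∑ (λ x → ∑ (f x) ys) xs        ≡⟨ cong (2 *_) (∑-swap f xs ys) ⟩
           2 * ∑ (λ y → ∑ (λ x → f x y) xs) ys ∎) =
    go fuel xs ys′ (s≤s⁻¹ (begin
        suc (length xs + length ys′) ≡⟨ +-suc (length xs) (length ys′) ⟨
        length xs + suc (length ys′) ≡⟨ cong (length xs +_) eq ⟨
        length xs + length ys        ≤⟨ bound ⟩
        suc fuel                     ∎)) xs! ys′! (begin-strict
      a * length xs + b * length ys′       ≡⟨ +-comm (a * length xs) _ ⟩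
      b * length ys′ + a * length xs       <⟨ heavy′ ⟩
      2 * ∑ (λ y → ∑ (λ x → f x y) xs) ys′ ≡⟨ cong (2 *_) (∑-swap f xs ys′) ⟨
      2 * ∑ (λ x → ∑ (f x) ys′) xs         ∎)

-- Zigzags of prescribed length in an oriented graph.

length-filter : ∀ {P : A → Set} (P? : Decidable P) xs → length (filter P? xs) ≡ ∑ (𝟙 ∘ does ∘ P?) xs
length-filter P? [] = refl
length-filter P? (x ∷ xs) with does (P? x)
... | true  = cong suc (length-filter P? xs)
... | false = length-filter P? xs

∑-cartesianProduct : ∀ (f : A × B → ℕ) xs ys →
  ∑ f (cartesianProduct xs ys) ≡ ∑ (λ x → ∑ (λ y → f (x , y)) ys) xs
∑-cartesianProduct f []       ys = refl
∑-cartesianProduct f (x ∷ xs) ys = begin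
  sum (map f (map (x ,_) ys ++ cartesianProduct xs ys)) ≡⟨ cong sum (map-++ f (map (x ,_) ys) _) ⟩
  sum (map f (map (x ,_) ys) ++ map f (cartesianProduct xs ys)) ≡⟨ sum-++ (map f (map (x ,_) ys)) _ ⟩
  ∑ f (map (x ,_) ys) + ∑ f (cartesianProduct xs ys)
    ≡⟨ cong₂ _+_ (cong sum (sym (map-∘ ys))) (∑-cartesianProduct f xs ys) ⟩
  ∑ (λ y → f (x , y)) ys + ∑ (λ x → ∑ (λ y → f (x , y)) ys) xs ∎
  where open ≡-Reasoning

witness : ∀ {P : Set} (P? : Dec P) → does P? ≡ true → P
witness (yes p) _ = p

hasEdge : (D : Digraph) → V D → V D → Bool
hasEdge D u v = does (edge? D u v)

size-∑ : ∀ D → size D ≡ ∑ (λ u → ∑ (𝟙 ∘ hasEdge D u) (allFin (order D))) (allFin (order D))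
size-∑ D = trans (length-filter (uncurry (edge? D)) (cartesianProduct (allFin _) (allFin _)))
                 (∑-cartesianProduct (𝟙 ∘ uncurry (hasEdge D)) (allFin _) (allFin _))

-- Forgets the core, which varies with the weights. The start is a tail for `b = true` and a head
-- for `b = false`.
record Zigzag {V : Set} (arc : V → V → Bool) (b : Bool) (k : ℕ) : Set where
  field
    start    : V
    rest     : List (Node V)
    linked   : Linked (Adj arc) ((b , start) ∷ rest)
    distinct : Unique (map proj₂ ((b , start) ∷ rest))
    edges    : length rest ≡ k

-- A path built from a vertex on side τ needs 3 r ≤ A to grow from 2 r + 1 vertices
-- and 3 r + 2 ≤ B to grow from 2 r + 2; the choices of A and B with A + B = 3 k - 4
-- in longZigzag (for k ≥ 2) meet these bounds up to the last step.
weights : Bool → ℕ → ℕ → Bool → ℕ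
weights τ A B b = if not τ xor b then A else B

weights-same : ∀ τ A B → weights τ A B τ ≡ A
weights-same true  A B = refl
weights-same false A B = refl

weights-opposite : ∀ τ A B → weights τ A B (not τ) ≡ B
weights-opposite true  A B = refl
weights-opposite false A B = refl

weights-total : ∀ τ A B → weights τ A B true + weights τ A B false ≡ A + B
weights-total true  A B = refl
weights-total false A B = +-comm B A

module Core (D : Digraph) (oriented : IsOriented D) (A B : ℕ)
            (many : (A + B) * order D < 2 * size D) (τ : Bool) where

  w : Bool → ℕ
  w = weights τ A B

  core : DenseCore (λ u v → 𝟙 (hasEdge D u v)) (w true) (w false)
  core = denseCore _ _ _ vs vs (allFin⁺ _) (allFin⁺ _) (begin-strict
    -- Each vertex enters the cover once per side, so it costs both weights.
    w true * length vs + w false * length vs ≡⟨ *-distribʳ-+ (length vs) (w true) (w false) ⟨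
    (w true + w false) * length vs ≡⟨ cong₂ _*_ (weights-total τ A B) (length-tabulate {n = order D} id) ⟩
    (A + B) * order D              <⟨ many ⟩
    2 * size D                     ≡⟨ cong (2 *_) (size-∑ D) ⟩
    2 * ∑ (λ u → ∑ (𝟙 ∘ hasEdge D u) vs) vs ∎)
    where
    open ≤-Reasoning
    vs = allFin (order D)

  open DenseCore core

  side : Bool → List (V D)
  side true  = rows
  side false = cols

  side-unique : ∀ b → Unique (side b)
  side-unique true  = rows!
  side-unique false = cols!

  side-dense : ∀ b {u} → u ∈ side b → w b < 2 * ∑ (𝟙 ∘ arcAt (hasEdge D) b u) (side (not b))
  side-dense true  = All.lookup rowDense
  side-dense false = All.lookup colDense

  deg : V D → ℕ
  deg u = ∑ (𝟙 ∘ hasEdge D u) cols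

  side-inhabited : ∀ b → ∃[ u ] u ∈ side b
  side-inhabited true  = let x , x∈ , _ = ∑-positive deg {rows} nonzero in x , x∈
  side-inhabited false =
    let x , _ , 0<deg = ∑-positive deg {rows} nonzero
        y , y∈ , _    = ∑-positive (𝟙 ∘ hasEdge D x) 0<deg
    in y , y∈

  antisym : ∀ {u v} → hasEdge D u v ≡ true → hasEdge D v u ≡ false
  antisym {u} {v} uv = dec-false (edge? D v u) (oriented (witness (edge? D u v) uv))

  open Extension Fin._≟_ (hasEdge D) antisym side side-unique w side-dense

  zigzag : ∀ {b p q k} → Path b p q → p + q ≡ suc k → Zigzag (hasEdge D) b k
  zigzag π p+q = record
    { linked = Path.linked π ; distinct = Path.distinct π
    ; edges = suc-injective (trans (length-nodes π) p+q) }

  -- The parity is that of the number of vertices: 2 r edges here, 2 r + 1 in `evenZigzag`, which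
  -- starts on the other side.
  oddZigzag : ∀ r → 3 * r ≤ 3 + A → 3 * r ≤ suc B → Zigzag (hasEdge D) τ (r + r)
  oddZigzag r r≤A r≤B = zigzag
    (oddPath τ (proj₂ (side-inhabited τ)) r
      (subst (λ a → 3 * r ≤ 3 + a) (sym (weights-same τ A B)) r≤A)
      (subst (λ b → 3 * r ≤ suc b) (sym (weights-opposite τ A B)) r≤B))
    refl

  evenZigzag : ∀ r → 3 * r ≤ A → 3 * r ≤ suc B → Zigzag (hasEdge D) (not τ) (suc (r + r))
  evenZigzag r r≤A r≤B = zigzag
    (evenPath τ (proj₂ (side-inhabited τ)) r
      (subst (3 * r ≤_) (sym (weights-same τ A B)) r≤A)
      (subst (λ b → 3 * r ≤ suc b) (sym (weights-opposite τ A B)) r≤B))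
    (cong suc (+-suc r r))

parity : ∀ k → ∃[ q ] (k ≡ q + q ⊎ k ≡ suc (q + q))
parity zero = 0 , inj₁ refl
parity (suc k) with parity k
... | q , inj₁ eq = q , inj₂ (cong suc eq)
... | q , inj₂ eq = suc q , inj₁ (cong suc (trans eq (sym (+-suc q q))))

longZigzag : ∀ k → 1 ≤ k → ∀ D → IsOriented D → 3 * k * order D < 2 * size D + 4 * order D →
             1 ≤ size D → ∀ b → Zigzag (hasEdge D) b k
-- Here 3 k - 4 is negative; both weights are 0 instead, and a single edge provides the surplus.
longZigzag 1 _ D oriented _ 1≤size b =
  subst (λ b → Zigzag _ b 1) (Bool.not-involutive b) (evenZigzag 0 z≤n z≤n)
  where open Core D oriented 0 0 (≤-trans 1≤size (m≤m+n (size D) _)) (not b)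
longZigzag (suc (suc k)) _ D oriented many _ b with parity k
-- Length 2 q + 2: A + B = 6 q + 2, and both bounds for r = q + 1 are equalities.
... | q , inj₁ refl =
  subst (Zigzag _ b) (cong suc (+-suc q q)) (oddZigzag (suc q) (≤-reflexive (*-suc 3 q)) (≤-reflexive (*-suc 3 q)))
  where
  expand : ∀ q n → (3 * q + (2 + 3 * q)) * n + 4 * n ≡ 3 * suc (suc (q + q)) * n
  expand = solve-∀
  open Core D oriented (3 * q) (2 + 3 * q)
    (+-cancelʳ-< (4 * order D) _ _ (subst (_< 2 * size D + 4 * order D) (sym (expand q (order D))) many)) b
-- Length 2 q + 3: the even path needs 3 (q + 1) ≤ A itself, so A is larger by 3 and A + B = 6 q +
-- 5.
... | q , inj₂ refl =
  subst₂ (Zigzag _) (Bool.not-involutive b) (cong (λ n → suc (suc n)) (+-suc q q))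
    (evenZigzag (suc q) (≤-reflexive (*-suc 3 q)) (≤-reflexive (*-suc 3 q)))
  where
  expand : ∀ q n → (3 + 3 * q + (2 + 3 * q)) * n + 4 * n ≡ 3 * suc (suc (suc (q + q))) * n
  expand = solve-∀
  open Core D oriented (3 + 3 * q) (2 + 3 * q)
    (+-cancelʳ-< (4 * order D) _ _ (subst (_< 2 * size D + 4 * order D) (sym (expand q (order D))) many)) (not b)

-- Embedding an antipath along a zigzag.

lookup-unique : ∀ {xs : List A} → Unique xs → ∀ {i j} → lookup xs i ≡ lookup xs j → i ≡ j
lookup-unique (_ ∷ _)    {zero}  {zero}  _  = refl
lookup-unique (x∉xs ∷ _) {zero}  {suc j} eq = contradiction eq (All.lookup x∉xs (∈-lookup j))
lookup-unique (x∉xs ∷ _) {suc i} {zero}  eq = contradiction (sym eq) (All.lookup x∉xs (∈-lookup i))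
lookup-unique (_ ∷ uniq) {suc i} {suc j} eq = cong suc (lookup-unique uniq eq)

lookup-linked : ∀ {R : A → A → Set} {xs} → Linked R xs →
                ∀ i j → toℕ j ≡ suc (toℕ i) → R (lookup xs i) (lookup xs j)
lookup-linked (r ∷ _)      zero    (suc zero) _  = r
lookup-linked (_ ∷ linked) (suc i) (suc j)    eq = lookup-linked linked i j (suc-injective eq)

-- The lengths of `map f xs` and `xs` agree only propositionally, so indices are matched through
-- `toℕ`.
lookup-map : ∀ (f : A → B) xs i →
             Σ[ j ∈ Fin (length (map f xs)) ] (toℕ j ≡ toℕ i × lookup (map f xs) j ≡ f (lookup xs i))
lookup-map f (x ∷ xs) zero = zero , refl , refl
lookup-map f (x ∷ xs) (suc i) with j , eq , eq′ ← lookup-map f xs i = suc j , cong suc eq , eq′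

filter-empty : ∀ {P : A → Set} (P? : Decidable P) {xs x} → length (filter P? xs) ≡ 0 → x ∈ xs → ¬ P x
filter-empty P? {xs} empty x∈ px with filter P? xs | empty | ∈-filter⁺ P? x∈ px
... | [] | _ | ()

alternate : ∀ {k P} → IsAntipath k P → ∀ {u v x} → Edge P u v → Edge P v x → ⊥
alternate {P = P} antipath {u} {v} {x} uv vx with IsAntipath.alternating antipath v
... | inj₁ out≡0 = filter-empty (edge? P v) out≡0 (∈-allFin x) vx
... | inj₂ in≡0  = filter-empty (λ u → edge? P u v) in≡0 (∈-allFin u) uv

-- Directions alternate along `P` and sides along the zigzag, so the first edge decides the rest.
-- The quantifier over `j` covers `k = 0`, where no index has value 1.
embed : ∀ {k P D} (antipath : IsAntipath k P) →
        let e = Inverse.to (IsOrientationOfPath.enumeration (IsAntipath.isOrientationOfPath antipath)) in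
        ∀ b → (∀ j → toℕ j ≡ 1 → if b then Edge P (e zero) (e j) else Edge P (e j) (e zero)) →
        Zigzag (hasEdge D) b k → D Contains P
embed {P = P} {D} antipath b first
      record { start = start ; rest = rest ; linked = linked ; distinct = distinct ; edges = refl } =
  f , injective , λ {u} {v} → preserves {u} {v}
  where
  open IsOrientationOfPath (IsAntipath.isOrientationOfPath antipath)
  open Inverse enumeration using (to; from; strictlyInverseˡ)

  nodes = (b , start) ∷ rest

  f : V P → V D
  f v = proj₂ (lookup nodes (from v))

  injective : ∀ {u v} → f u ≡ f v → u ≡ v
  injective {u} {v} eq
    with i , i≡ , fi ← lookup-map proj₂ nodes (from u) | j , j≡ , fj ← lookup-map proj₂ nodes (from v) =
    trans (sym (strictlyInverseˡ u)) (trans (cong to (Fin.toℕ-injective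
      (trans (sym i≡) (trans (cong toℕ (lookup-unique distinct (trans fi (trans eq (sym fj))))) j≡))))
      (strictlyInverseˡ v))

  Directed : Bool → V P → V P → Set
  Directed c u v = if c then Edge P u v else Edge P v u

  turnaround : ∀ c d {u v x} → c xor d ≡ true → Directed c u v → Adjacent P v x → Directed d v x
  turnaround true  false _ uv (inj₁ vx) = ⊥-elim (alternate antipath uv vx)
  turnaround true  false _ uv (inj₂ xv) = xv
  turnaround false true  _ vu (inj₁ vx) = vx
  turnaround false true  _ vu (inj₂ xv) = ⊥-elim (alternate antipath xv vu)

  xor-of-adj : ∀ x y → Adj (hasEdge D) x y → proj₁ x xor proj₁ y ≡ true
  xor-of-adj (true , _)  (false , _) _ = refl
  xor-of-adj (false , _) (true , _)  _ = refl

  -- Induction along the path: at the vertex `to (suc i)` both the side of the node and the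
  -- direction of the edge flip.
  directed : ∀ n i j → toℕ i ≡ n → toℕ j ≡ suc n → Directed (proj₁ (lookup nodes i)) (to i) (to j)
  directed zero    zero    j _  j≡ = first j j≡
  directed (suc n) (suc i) j i≡ j≡ =
    turnaround (proj₁ (lookup nodes i⁻)) _ (xor-of-adj (lookup nodes i⁻) (lookup nodes (suc i))
        (lookup-linked linked i⁻ (suc i) (cong suc (sym (Fin.toℕ-inject₁ i)))))
      (directed n i⁻ (suc i) (trans (Fin.toℕ-inject₁ i) (suc-injective i≡)) i≡)
      (Equivalence.from (adjacency (suc i) j) (inj₁ (trans j≡ (cong suc (sym i≡)))))
    where i⁻ = inject₁ i

  arc-between : ∀ c {u v} → Directed c u v → Edge P u v → c ≡ true
  arc-between true  _  _  = refl
  arc-between false vu uv = ⊥-elim (oriented uv vu)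

  arc-between′ : ∀ c {u v} → Directed c u v → Edge P v u → c ≡ false
  arc-between′ false _  _  = refl
  arc-between′ true uv vu = ⊥-elim (oriented uv vu)

  forward : ∀ x y → proj₁ x ≡ true → Adj (hasEdge D) x y → Edge D (proj₂ x) (proj₂ y)
  forward (true , u) (false , v) _ uv = witness (edge? D u v) uv

  backward : ∀ x y → proj₁ x ≡ false → Adj (hasEdge D) x y → Edge D (proj₂ y) (proj₂ x)
  backward (false , u) (true , v) _ vu = witness (edge? D v u) vu

  preserves : ∀ {u v} → Edge P u v → Edge D (f u) (f v)
  preserves {u} {v} uv
    with uv′ ← subst₂ (Edge P) (sym (strictlyInverseˡ u)) (sym (strictlyInverseˡ v)) uv
    with Equivalence.to (adjacency (from u) (from v)) (inj₁ uv′)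
  ... | inj₁ v≡1+u = forward (lookup nodes (from u)) (lookup nodes (from v))
    (arc-between _ (directed _ (from u) (from v) refl v≡1+u) uv′) (lookup-linked linked (from u) (from v) v≡1+u)
  -- This edge of `P` runs against the enumeration, so the earlier node is a head.
  ... | inj₂ u≡1+v = backward (lookup nodes (from v)) (lookup nodes (from u))
    (arc-between′ _ (directed _ (from v) (from u) refl u≡1+v) uv′) (lookup-linked linked (from v) (from u) u≡1+v)

-- The edge bound and the conclusion.

naturalBound : ∀ k n s →
  (ℤ.+ 3 ℤ.* ℤ.+ k ℤ.- ℤ.+ 4) ℤ.* ℤ.+ n ℤ.< ℤ.+ 2 ℤ.* ℤ.+ s → 3 * k * n < 2 * s + 4 * n
naturalBound k n s h = ℤ.drop‿+<+ (begin-strict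
  ℤ.+ (3 * k * n)                    ≡⟨ ℤ.pos-* (3 * k) n ⟩
  ℤ.+ (3 * k) ℤ.* ℤ.+ n              ≡⟨ cong (ℤ._* ℤ.+ n) (ℤ.pos-* 3 k) ⟩
  -- The factor 3 k - 4 may be negative, so 4 n moves across before the descent to naturals.
  ℤ.+ 3 ℤ.* ℤ.+ k ℤ.* ℤ.+ n          ≡⟨ split (ℤ.+ k) (ℤ.+ n) ⟩
  (ℤ.+ 3 ℤ.* ℤ.+ k ℤ.- ℤ.+ 4) ℤ.* ℤ.+ n ℤ.+ ℤ.+ 4 ℤ.* ℤ.+ n <⟨ ℤ.+-monoˡ-< _ h ⟩
  ℤ.+ 2 ℤ.* ℤ.+ s ℤ.+ ℤ.+ 4 ℤ.* ℤ.+ n ≡⟨ cong₂ ℤ._+_ (ℤ.pos-* 2 s) (ℤ.pos-* 4 n) ⟨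
  ℤ.+ (2 * s) ℤ.+ ℤ.+ (4 * n)        ≡⟨ ℤ.pos-+ (2 * s) (4 * n) ⟨
  ℤ.+ (2 * s + 4 * n)                ∎)
  where
  open ℤ.≤-Reasoning
  split : ∀ k n → ℤ.+ 3 ℤ.* k ℤ.* n ≡ (ℤ.+ 3 ℤ.* k ℤ.- ℤ.+ 4) ℤ.* n ℤ.+ ℤ.+ 4 ℤ.* n
  split = ℤSolver.solve-∀

theorem4 : (k : ℕ) → 1 ≤ k →
    (D : Digraph) → IsOriented D →
    (ℤ.+ 3 ℤ.* ℤ.+ k ℤ.- ℤ.+ 4) ℤ.* ℤ.+ order D ℤ.< ℤ.+ 2 ℤ.* ℤ.+ size D →
    1 ≤ size D →
    (P : Digraph) → IsAntipath k P → D Contains P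
theorem4 k@(suc _) 1≤k D oriented bound 1≤size P antipath =
  -- The direction of the first edge of `P` decides whether the zigzag starts at a tail or a head;
  -- for even `k` this separates the two antipaths.
  case Equivalence.from (adjacency zero (suc zero)) (inj₁ refl) of λ where
    (inj₁ e₀e₁) → go true λ { (suc zero) refl → e₀e₁ }
    (inj₂ e₁e₀) → go false λ { (suc zero) refl → e₁e₀ }
  where
  open IsOrientationOfPath (IsAntipath.isOrientationOfPath antipath) using (adjacency)
  go = λ b first → embed {D = D} antipath b first
    (longZigzag k 1≤k D oriented (naturalBound k (order D) (size D) bound) 1≤size b)
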